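{- There exist a constant $c>0$ and a function $g:\mathbb{N}\to\mathbb{R}_{\ge 0}$ with $g(n)/n\to 0$ as $n\to\infty$ such that for every positive integer $n$ there is a set of at most $2^{g(n)}$ permutations of $[n]=\{1,\dots,n\}$ such that any sequence containing all these permutations as subsequences has length at least $c\,n^2$.
   Context: Permutations of $[n]$ are regarded as ordered arrangements, i.e. words $i_1i_2\dots i_n$ in which each element of $[n]$ appears exactly once. A subsequence of a sequence $s$ is any sequence obtained by deleting some (possibly no) elements of $s$; its letters need not be contiguous in $s$. -}

module Defs where

open import Data.Fin.Base using (Fin)
open import Data.Integer.Base using (+_; -[1+_])
open import Data.List.Base using (List)
open import Data.List.Membership.Propositional using (_∈_)
open import Data.List.Relation.Unary.Unique.Propositional using (Unique)
open import Data.Nat.Base as ℕ using (ℕ; suc; NonZero)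
open import Data.Product.Base using (∃-syntax; _×_)
open import Data.Rational.Base as ℚ using (ℚ; mkℚ; 0ℚ; _/_)

-- Letters are Fin n = {0, …, n-1} instead of {1, …, n}.
Word : ℕ → Set
Word n = List (Fin n)

record IsPermutation {n : ℕ} (w : Word n) : Set where
  field
    atMostOnce  : Unique w
    atLeastOnce : ∀ (i : Fin n) → i ∈ w

fromℕ : ℕ → ℚ
fromℕ m = + m / 1

-- k ≤2^ q says k ≤ 2^q for a rational exponent q = p/d with d > 0; raising
-- both sides to the d-th power turns this into k^d ≤ 2^p, which for a negative
-- numerator -p becomes k^d · 2^p ≤ 1.
infix 4 _≤2^_
_≤2^_ : ℕ → ℚ → Set
k ≤2^ mkℚ (+ p)    d-1 _ = k ℕ.^ suc d-1 ℕ.≤ 2 ℕ.^ p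
k ≤2^ mkℚ -[1+ p ] d-1 _ = k ℕ.^ suc d-1 ℕ.* 2 ℕ.^ suc p ℕ.≤ 1

-- g(n)/n → 0 as n → ∞.
Sublinear : (ℕ → ℚ) → Set
Sublinear g = ∀ (ε : ℚ) → 0ℚ ℚ.< ε →
  ∃[ N ] (∀ (n : ℕ) .{{_ : NonZero n}} → N ℕ.≤ n → ℚ.∣ g n ℚ.* (+ 1 / n) ∣ ℚ.< ε)

{-# OPTIONS --safe #-}
module Submission where

-- The argument is by counting. A word w has at most C(|w|, n) ≤ |w|^n / n! subsequences of
-- length n, so, since n^n ≤ 4^n n!, a word with 32 |w| ≤ n² contains at most a fraction 2^-n of
-- all n! permutations. By averaging, some permutation is contained in at most a fraction 2^-n of
-- any given set of such words; choosing permutations greedily, each one shrinks the set of words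
-- containing all the previous ones by the factor 2^-n. There are at most (n+1)^L ≤ 2^(nL) words
-- of length at most L = ⌊n²/32⌋, so L + 1 ≤ n² permutations leave none: g(n) = O(log n) suffices.

open import Defs
open import Algebra.Properties.CommutativeSemigroup using (x∙yz≈y∙xz; interchange)
open import Data.Empty using (⊥-elim)
open import Data.Fin.Base using (Fin; punchIn; punchOut)
import Data.Fin.Properties as Fin
open import Data.Integer.Base as ℤ using (+_; -[1+_])
import Data.Integer.Properties as ℤ
open import Data.List.Base
  using (List; []; _∷_; [_]; _++_; length; map; filter; allFin; cartesianProductWith; deduplicate)
open import Data.List.Membership.Propositional using (_∈_)
open import Data.List.Membership.Propositional.Properties
  using (∈-∃++; ∈-++⁺ˡ; ∈-++⁺ʳ; ∈-++⁻; ∈-map⁺; ∈-map⁻; ∈-filter⁺; ∈-filter⁻; ∈-allFin; ∈-deduplicate⁺;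
         ∈-cartesianProductWith⁺; ∈-cartesianProductWith⁻)
open import Data.List.Properties
  using (length-++; length-map; length-tabulate; ≡-dec; ∷-injective;
         map-injective; length-deduplicate)
open import Data.List.Relation.Binary.Sublist.Propositional using (_⊆_; []; _∷_; _∷ʳ_)
import Data.List.Relation.Binary.Sublist.DecPropositional as DecSublist
open import Data.List.Relation.Unary.All as All using (All; []; _∷_)
import Data.List.Relation.Unary.All.Properties as All
open import Data.List.Relation.Unary.Any using (here; there)
open import Data.List.Relation.Unary.AllPairs using ([]; _∷_)
open import Data.List.Relation.Unary.Unique.Propositional using (Unique)
import Data.List.Relation.Unary.Unique.Propositional.Properties as Unique
import Data.List.Relation.Unary.Unique.DecPropositional.Properties as DecUnique
open import Data.Nat.Base as ℕ using (ℕ; zero; suc; _^_; _!; z≤n; s≤s; NonZero)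
open import Data.Nat.Coprimality using (1-coprimeTo) renaming (sym to coprime-sym)
open import Data.Nat.DivMod using (m/n<m; m/n*n≤m; m≡m%n+[m/n]*n; m%n<n)
open import Data.Nat.ListAction using (sum)
import Data.Nat.Properties as ℕ
open import Data.Nat.Tactic.RingSolver using (solve-∀)
open import Data.Product.Base using (Σ-syntax; ∃-syntax; _×_; _,_; proj₁; proj₂)
open import Data.Rational.Base using (ℚ; mkℚ; 0ℚ; _<_; _≤_; _*_; *<*; *≤*; _/_; ↧ₙ_; toℚᵘ; ∣_∣)
import Data.Rational.Properties as ℚ
import Data.Rational.Unnormalised.Base as ℚᵘ
import Data.Rational.Unnormalised.Properties as ℚᵘ
open import Data.Sum.Base using (inj₁; inj₂)
open import Function.Base using (flip)
open import Level using (Level)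
open import Relation.Binary.Core using (REL)
import Relation.Binary.Definitions as B
open import Relation.Binary.PropositionalEquality
  using (_≡_; refl; sym; trans; cong; cong₂; subst)
open import Relation.Nullary using (¬_; yes; no)

private
  variable
    a b r : Level
    A B : Set a

-- Counting and averaging over finite lists.

unique-⊆⇒length≤ : {xs ys : List A} → Unique xs → (∀ {x} → x ∈ xs → x ∈ ys) →
                   length xs ℕ.≤ length ys
unique-⊆⇒length≤ {xs = []} _ _ = z≤n
unique-⊆⇒length≤ {xs = x ∷ xs} (x∉xs ∷ xs!) sub with ∈-∃++ (sub (here refl))
... | as , bs , refl = begin
  suc (length xs)               ≤⟨ s≤s (unique-⊆⇒length≤ xs! sub′) ⟩
  suc (length (as ++ bs))       ≡⟨ cong suc (length-++ as) ⟩
  suc (length as ℕ.+ length bs) ≡⟨ ℕ.+-suc (length as) (length bs) ⟨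
  length as ℕ.+ suc (length bs) ≡⟨ length-++ as ⟨
  length (as ++ x ∷ bs)         ∎
  where
  open ℕ.≤-Reasoning
  sub′ : ∀ {y} → y ∈ xs → y ∈ as ++ bs
  sub′ y∈xs with ∈-++⁻ as (sub (there y∈xs))
  ... | inj₁ y∈as          = ∈-++⁺ˡ y∈as
  ... | inj₂ (here refl)   = ⊥-elim (All.lookup x∉xs y∈xs refl)
  ... | inj₂ (there y∈bs)  = ∈-++⁺ʳ as y∈bs

length-cartesianProductWith : {C : Set r} (f : A → B → C) (xs : List A) (ys : List B) →
  length (cartesianProductWith f xs ys) ≡ length xs ℕ.* length ys
length-cartesianProductWith f []       ys = refl
length-cartesianProductWith f (x ∷ xs) ys = trans (length-++ (map (f x) ys))
  (cong₂ ℕ._+_ (length-map (f x) ys) (length-cartesianProductWith f xs ys))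

sum-map-* : ∀ (f : A → ℕ) k xs → sum (map (λ x → f x ℕ.* k) xs) ≡ sum (map f xs) ℕ.* k
sum-map-* f k []       = refl
sum-map-* f k (x ∷ xs) = trans (cong (f x ℕ.* k ℕ.+_) (sum-map-* f k xs)) (sym (ℕ.*-distribʳ-+ k (f x) _))

-- An entry above `T` takes more than its share of the total, so the remaining entries satisfy the
-- same bound for a list shorter by one.
∃≤average : (f : A → ℕ) (xs : List A) (T : ℕ) → 1 ℕ.≤ length xs →
            sum (map f xs) ℕ.≤ length xs ℕ.* T → ∃[ x ] (x ∈ xs × f x ℕ.≤ T)
∃≤average f (x ∷ xs) T _ le with f x ℕ.≤? T
... | yes fx≤T = x , here refl , fx≤T
∃≤average f (x ∷ []) T _ le | no fx≰T =
  ⊥-elim (fx≰T (ℕ.+-cancelʳ-≤ 0 (f x) T le))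
∃≤average f (x ∷ xs@(_ ∷ _)) T _ le | no fx≰T
  with ∃≤average f xs T (s≤s z≤n)
         (ℕ.+-cancelˡ-≤ T _ _ (ℕ.≤-trans (ℕ.+-monoˡ-≤ _ (ℕ.<⇒≤ (ℕ.≰⇒> fx≰T))) le))
... | y , y∈xs , fy≤T = y , there y∈xs , fy≤T

-- Double counting and the greedy choice of a family.

module _ {R : REL A B r} (R? : B.Decidable R) where

  -- `R` is a bipartite graph, with degrees on its two sides. In the application `as` lists the
  -- permutations, `bs` the candidate words, and `R` is the subsequence relation.
  degreeˡ : List B → A → ℕ
  degreeˡ bs a = length (filter (R? a) bs)

  degreeʳ : List A → B → ℕ
  degreeʳ as b = length (filter (flip R? b) as)

  sum-degreeˡ-∷ : ∀ as b bs →
    sum (map (degreeˡ (b ∷ bs)) as) ≡ degreeʳ as b ℕ.+ sum (map (degreeˡ bs) as)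
  sum-degreeˡ-∷ [] b bs = refl
  sum-degreeˡ-∷ (a ∷ as) b bs with ih ← sum-degreeˡ-∷ as b bs | R? a b
  ... | yes _ = cong suc (trans (cong (degreeˡ bs a ℕ.+_) ih) (x∙yz≈y∙xz ℕ.+-commutativeSemigroup (degreeˡ bs a) (degreeʳ as b) _))
  ... | no _  = trans (cong (degreeˡ bs a ℕ.+_) ih) (x∙yz≈y∙xz ℕ.+-commutativeSemigroup (degreeˡ bs a) (degreeʳ as b) _)

  module _ (as : List A) (K : ℕ) where

    Rare : B → Set
    Rare b = degreeʳ as b ℕ.* K ℕ.≤ length as

    -- Double counting: the edges are counted from the side of `bs`, where rarity bounds each
    -- degree.
    sum-degreeˡ-rare : ∀ {bs} → All Rare bs →
      sum (map (degreeˡ bs) as) ℕ.* K ℕ.≤ length as ℕ.* length bs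
    sum-degreeˡ-rare [] = ℕ.≤-reflexive (trans (cong (ℕ._* K) (sum-zeros as)) (sym (ℕ.*-zeroʳ (length as))))
      where
      sum-zeros : ∀ as → sum (map (degreeˡ []) as) ≡ 0
      sum-zeros []       = refl
      sum-zeros (_ ∷ as) = sum-zeros as
    sum-degreeˡ-rare {b ∷ bs} (rare ∷ rares) = begin
      sum (map (degreeˡ (b ∷ bs)) as) ℕ.* K                       ≡⟨ cong (ℕ._* K) (sum-degreeˡ-∷ as b bs) ⟩
      (degreeʳ as b ℕ.+ sum (map (degreeˡ bs) as)) ℕ.* K          ≡⟨ ℕ.*-distribʳ-+ K (degreeʳ as b) _ ⟩
      degreeʳ as b ℕ.* K ℕ.+ sum (map (degreeˡ bs) as) ℕ.* K      ≤⟨ ℕ.+-mono-≤ rare (sum-degreeˡ-rare rares) ⟩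
      length as ℕ.+ length as ℕ.* length bs                       ≡⟨ ℕ.*-suc (length as) (length bs) ⟨
      length as ℕ.* suc (length bs)                               ∎
      where open ℕ.≤-Reasoning

    -- Rarity makes the average degree over `as` at most `length bs` divided by `K`. Some `a` does
    -- no worse; only its neighbours in `bs` survive, they are still rare, and the choice is
    -- repeated on them. After `M` rounds fewer than one survivor is left.
    ∃-avoiding-family : 1 ℕ.≤ length as → ∀ M {bs} → All Rare bs → length bs ℕ.< K ^ M →
      ∃[ S ] (length S ≡ M × All (_∈ as) S × (∀ {b} → b ∈ bs → ¬ All (λ a → R a b) S))
    ∃-avoiding-family ne zero {[]} rares lt = [] , refl , [] , λ ()
    ∃-avoiding-family ne zero {b ∷ bs} rares (s≤s ())
    ∃-avoiding-family ne (suc M) {bs} rares lt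
      -- Averaging the degree times `K` makes the threshold the integer `length bs`, with no
      -- rounding.
      with a , a∈as , few ← ∃≤average (λ a → degreeˡ bs a ℕ.* K) as (length bs) ne
             (ℕ.≤-trans (ℕ.≤-reflexive (sum-map-* (degreeˡ bs) K as)) (sum-degreeˡ-rare rares))
      with S , len , S⊆as , avoid ← ∃-avoiding-family ne M (All.filter⁺ (R? a) rares)
             (ℕ.*-cancelˡ-< K _ _ (ℕ.≤-<-trans (ℕ.≤-reflexive (ℕ.*-comm K _)) (ℕ.≤-<-trans few lt)))
      = a ∷ S , cong suc len , a∈as ∷ S⊆as
      , λ { b∈bs (Rab ∷ RSb) → avoid (∈-filter⁺ (R? a) b∈bs Rab) RSb }

-- Counting the subsequences of a word.

subsequences : ℕ → List A → List (List A)
subsequences zero    _        = [ [] ]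
subsequences (suc k) []       = []
subsequences (suc k) (x ∷ xs) = map (x ∷_) (subsequences k xs) ++ subsequences (suc k) xs

∈-subsequences : {s w : List A} → s ⊆ w → s ∈ subsequences (length s) w
∈-subsequences []                         = here refl
∈-subsequences {s = []}    (y ∷ʳ s⊆w)     = here refl
∈-subsequences {s = x ∷ s} {w = y ∷ w} (.y ∷ʳ s⊆w) =
  ∈-++⁺ʳ (map (y ∷_) (subsequences (length s) w)) (∈-subsequences s⊆w)
∈-subsequences (refl ∷ s⊆w)               = ∈-++⁺ˡ (∈-map⁺ _ (∈-subsequences s⊆w))

-- These are the two leading terms of the binomial expansion of the right-hand side, in the shape
-- that Pascal's rule produces in `length-subsequences`.
bernoulli : ∀ l k → l ^ suc k ℕ.+ suc k ℕ.* l ^ k ℕ.≤ suc l ^ suc k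
bernoulli l zero    = ℕ.≤-reflexive (base l)
  where
  base : ∀ l → l ℕ.* 1 ℕ.+ 1 ≡ suc l ℕ.* 1
  base = solve-∀
bernoulli l (suc k) = begin
  l ^ suc (suc k) ℕ.+ suc (suc k) ℕ.* l ^ suc k                            ≤⟨ ℕ.m≤m+n _ (suc k ℕ.* l ^ k) ⟩
  l ^ suc (suc k) ℕ.+ suc (suc k) ℕ.* l ^ suc k ℕ.+ suc k ℕ.* l ^ k        ≡⟨ expand l k (l ^ k) ⟩
  suc l ℕ.* (l ^ suc k ℕ.+ suc k ℕ.* l ^ k)                                ≤⟨ ℕ.*-monoʳ-≤ (suc l) (bernoulli l k) ⟩
  suc l ^ suc (suc k)                                                      ∎
  where
  open ℕ.≤-Reasoning
  expand : ∀ l k p → l ℕ.* (l ℕ.* p) ℕ.+ suc (suc k) ℕ.* (l ℕ.* p) ℕ.+ suc k ℕ.* p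
                   ≡ suc l ℕ.* (l ℕ.* p ℕ.+ suc k ℕ.* p)
  expand = solve-∀

-- `subsequences` chooses positions, so its length is a binomial coefficient obeying Pascal's rule.
-- Multiplied by the factorial and bounded inductively, the two terms of that rule become the
-- left-hand side of `bernoulli`.
length-subsequences : ∀ k (w : List A) → length (subsequences k w) ℕ.* k ! ℕ.≤ length w ^ k
length-subsequences zero    w       = ℕ.≤-refl
length-subsequences (suc k) []      = z≤n
length-subsequences (suc k) (x ∷ w) = begin
  length (map (x ∷_) (subsequences k w) ++ subsequences (suc k) w) ℕ.* suc k !
    ≡⟨ cong (ℕ._* suc k !) (trans (length-++ (map (x ∷_) (subsequences k w))) (cong (ℕ._+ v) (length-map (x ∷_) (subsequences k w)))) ⟩
  (u ℕ.+ v) ℕ.* suc k !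
    ≡⟨ split u v k (k !) ⟩
  v ℕ.* suc k ! ℕ.+ suc k ℕ.* (u ℕ.* k !)
    ≤⟨ ℕ.+-mono-≤ (length-subsequences (suc k) w) (ℕ.*-monoʳ-≤ (suc k) (length-subsequences k w)) ⟩
  length w ^ suc k ℕ.+ suc k ℕ.* length w ^ k
    ≤⟨ bernoulli (length w) k ⟩
  suc (length w) ^ suc k ∎
  where
  open ℕ.≤-Reasoning
  u v : ℕ
  u = length (subsequences k w)
  v = length (subsequences (suc k) w)
  split : ∀ u v k f → (u ℕ.+ v) ℕ.* (suc k ℕ.* f) ≡ v ℕ.* (suc k ℕ.* f) ℕ.+ suc k ℕ.* (u ℕ.* f)
  split = solve-∀

-- Elementary factorial estimates.

m^k*m!≤[k+m]! : ∀ m k → m ^ k ℕ.* m ! ℕ.≤ (k ℕ.+ m) !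
m^k*m!≤[k+m]! m zero    = ℕ.≤-reflexive (ℕ.+-identityʳ (m !))
m^k*m!≤[k+m]! m (suc k) = begin
  m ℕ.* m ^ k ℕ.* m !           ≡⟨ ℕ.*-assoc m (m ^ k) (m !) ⟩
  m ℕ.* (m ^ k ℕ.* m !)         ≤⟨ ℕ.*-mono-≤ (ℕ.m≤n+m m (suc k)) (m^k*m!≤[k+m]! m k) ⟩
  suc (k ℕ.+ m) ℕ.* (k ℕ.+ m) ! ∎
  where open ℕ.≤-Reasoning

-- The binomial coefficient of `k + m` over `k` is at most the number of all subsets. The induction
-- is Pascal's rule with denominators cleared.
[k+m]!≤2^[k+m]*m!*k! : ∀ m k → (k ℕ.+ m) ! ℕ.≤ 2 ^ (k ℕ.+ m) ℕ.* (m ! ℕ.* k !)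
[k+m]!≤2^[k+m]*m!*k! m zero = begin
  m !                       ≡⟨ trans (ℕ.*-identityˡ _) (ℕ.*-identityʳ _) ⟨
  1 ℕ.* (m ! ℕ.* 1)         ≤⟨ ℕ.*-monoˡ-≤ (m ! ℕ.* 1) (ℕ.m^n>0 2 m) ⟩
  2 ^ m ℕ.* (m ! ℕ.* 1)     ∎
  where open ℕ.≤-Reasoning
[k+m]!≤2^[k+m]*m!*k! zero (suc k) = begin
  (suc k ℕ.+ 0) !                                ≡⟨ cong _! (ℕ.+-identityʳ (suc k)) ⟩
  suc k !                                        ≡⟨ trans (ℕ.*-identityˡ _) (ℕ.*-identityˡ _) ⟨
  1 ℕ.* (1 ℕ.* suc k !)                          ≤⟨ ℕ.*-monoˡ-≤ (1 ℕ.* suc k !) (ℕ.m^n>0 2 (suc k ℕ.+ 0)) ⟩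
  2 ^ (suc k ℕ.+ 0) ℕ.* (1 ℕ.* suc k !)          ∎
  where open ℕ.≤-Reasoning
[k+m]!≤2^[k+m]*m!*k! (suc m) (suc k) = begin
  suc (k ℕ.+ suc m) ℕ.* (k ℕ.+ suc m) !
    ≡⟨ cong (λ t → suc t ℕ.* (k ℕ.+ suc m) !) (ℕ.+-suc k m) ⟩
  suc (suc (k ℕ.+ m)) ℕ.* (k ℕ.+ suc m) !
    ≡⟨ split m k ((k ℕ.+ suc m) !) ⟩
  suc k ℕ.* (k ℕ.+ suc m) ! ℕ.+ suc m ℕ.* (k ℕ.+ suc m) !
    ≡⟨ cong (λ t → suc k ℕ.* (k ℕ.+ suc m) ! ℕ.+ suc m ℕ.* t !) (ℕ.+-suc k m) ⟩
  suc k ℕ.* (k ℕ.+ suc m) ! ℕ.+ suc m ℕ.* (suc k ℕ.+ m) !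
    ≤⟨ ℕ.+-mono-≤ (ℕ.*-monoʳ-≤ (suc k) ([k+m]!≤2^[k+m]*m!*k! (suc m) k))
                  (ℕ.*-monoʳ-≤ (suc m) ([k+m]!≤2^[k+m]*m!*k! m (suc k))) ⟩
  suc k ℕ.* (2 ^ (k ℕ.+ suc m) ℕ.* (suc m ! ℕ.* k !)) ℕ.+ suc m ℕ.* (2 ^ (suc k ℕ.+ m) ℕ.* (m ! ℕ.* suc k !))
    ≡⟨ cong (λ t → suc k ℕ.* (2 ^ (k ℕ.+ suc m) ℕ.* (suc m ! ℕ.* k !)) ℕ.+ suc m ℕ.* (2 ^ t ℕ.* (m ! ℕ.* suc k !))) (ℕ.+-suc k m) ⟨
  suc k ℕ.* (2 ^ (k ℕ.+ suc m) ℕ.* (suc m ! ℕ.* k !)) ℕ.+ suc m ℕ.* (2 ^ (k ℕ.+ suc m) ℕ.* (m ! ℕ.* suc k !))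
    ≡⟨ merge m k (2 ^ (k ℕ.+ suc m)) (m !) (k !) ⟩
  2 ^ (suc k ℕ.+ suc m) ℕ.* (suc m ! ℕ.* suc k !) ∎
  where
  open ℕ.≤-Reasoning
  split : ∀ m k f → suc (suc (k ℕ.+ m)) ℕ.* f ≡ suc k ℕ.* f ℕ.+ suc m ℕ.* f
  split = solve-∀
  merge : ∀ m k p x y →
    suc k ℕ.* (p ℕ.* (suc m ℕ.* x ℕ.* y)) ℕ.+ suc m ℕ.* (p ℕ.* (x ℕ.* (suc k ℕ.* y)))
      ≡ 2 ℕ.* p ℕ.* (suc m ℕ.* x ℕ.* (suc k ℕ.* y))
  merge = solve-∀

^-distribʳ-* : ∀ k m n → (m ℕ.* n) ^ k ≡ m ^ k ℕ.* n ^ k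
^-distribʳ-* zero    m n = refl
^-distribʳ-* (suc k) m n = trans (cong (m ℕ.* n ℕ.*_) (^-distribʳ-* k m n))
  (interchange ℕ.*-commutativeSemigroup m n (m ^ k) (n ^ k))

-- Sandwiching `(n + n) !` between the two preceding bounds takes the place of Stirling's formula.
n^n≤4^n*n! : ∀ n → n ^ n ℕ.≤ 4 ^ n ℕ.* n !
n^n≤4^n*n! n = ℕ.*-cancelʳ-≤ (n ^ n) (4 ^ n ℕ.* n !) (n !) {{n ℕ.!≢0}} (begin
  n ^ n ℕ.* n !                     ≤⟨ m^k*m!≤[k+m]! n n ⟩
  (n ℕ.+ n) !                       ≤⟨ [k+m]!≤2^[k+m]*m!*k! n n ⟩
  2 ^ (n ℕ.+ n) ℕ.* (n ! ℕ.* n !)   ≡⟨ cong (ℕ._* (n ! ℕ.* n !)) 2^[n+n]≡4^n ⟩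
  4 ^ n ℕ.* (n ! ℕ.* n !)           ≡⟨ ℕ.*-assoc (4 ^ n) (n !) (n !) ⟨
  4 ^ n ℕ.* n ! ℕ.* n !             ∎)
  where
  open ℕ.≤-Reasoning
  2^[n+n]≡4^n : 2 ^ (n ℕ.+ n) ≡ 4 ^ n
  2^[n+n]≡4^n = trans (cong (2 ^_) (cong (n ℕ.+_) (sym (ℕ.+-identityʳ n)))) (sym (ℕ.^-*-assoc 2 2 n))

-- The constant 32 is 2 · 4 · 4: replacing both factors `n ^ n` of `(n ^ 2) ^ n` by `4 ^ n * n !`
-- costs `16 ^ n`, and the remaining 2 gives the saving `2 ^ n`.
length-subsequences*2^n≤n! : ∀ n (w : List A) → length w ℕ.* 32 ℕ.≤ n ^ 2 →
                             length (subsequences n w) ℕ.* 2 ^ n ℕ.≤ n !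
length-subsequences*2^n≤n! n w short =
  ℕ.*-cancelʳ-≤ (c ℕ.* 2 ^ n) (n !) (16 ^ n ℕ.* n !)
    {{ℕ.m*n≢0 (16 ^ n) (n !) {{ℕ.m^n≢0 16 n}} {{n ℕ.!≢0}}}} (begin
  c ℕ.* 2 ^ n ℕ.* (16 ^ n ℕ.* n !)           ≡⟨ regroup c (2 ^ n) (16 ^ n) (n !) ⟩
  c ℕ.* n ! ℕ.* (2 ^ n ℕ.* 16 ^ n)           ≡⟨ cong (c ℕ.* n ! ℕ.*_) (^-distribʳ-* n 2 16) ⟨
  c ℕ.* n ! ℕ.* 32 ^ n                       ≤⟨ ℕ.*-monoˡ-≤ (32 ^ n) (length-subsequences n w) ⟩
  length w ^ n ℕ.* 32 ^ n                    ≡⟨ ^-distribʳ-* n (length w) 32 ⟨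
  (length w ℕ.* 32) ^ n                      ≤⟨ ℕ.^-monoˡ-≤ n short ⟩
  (n ^ 2) ^ n                                ≡⟨ cong (_^ n) (cong (n ℕ.*_) (ℕ.*-identityʳ n)) ⟩
  (n ℕ.* n) ^ n                              ≡⟨ ^-distribʳ-* n n n ⟩
  n ^ n ℕ.* n ^ n                            ≤⟨ ℕ.*-mono-≤ (n^n≤4^n*n! n) (n^n≤4^n*n! n) ⟩
  4 ^ n ℕ.* n ! ℕ.* (4 ^ n ℕ.* n !)          ≡⟨ regroup′ (4 ^ n) (n !) ⟩
  n ! ℕ.* (4 ^ n ℕ.* 4 ^ n ℕ.* n !)          ≡⟨ cong (λ t → n ! ℕ.* (t ℕ.* n !)) (^-distribʳ-* n 4 4) ⟨
  n ! ℕ.* (16 ^ n ℕ.* n !)                   ∎)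
  where
  open ℕ.≤-Reasoning
  c : ℕ
  c = length (subsequences n w)
  regroup : ∀ c p q f → c ℕ.* p ℕ.* (q ℕ.* f) ≡ c ℕ.* f ℕ.* (p ℕ.* q)
  regroup = solve-∀
  regroup′ : ∀ q f → q ℕ.* f ℕ.* (q ℕ.* f) ≡ f ℕ.* (q ℕ.* q ℕ.* f)
  regroup′ = solve-∀

-- Enumeration of permutations and words.

insertFirst : ∀ {n} → Fin (suc n) → Word n → Word (suc n)
insertFirst i w = i ∷ map (punchIn i) w

insertFirst-injective : ∀ {n} {i j : Fin (suc n)} {v w : Word n} →
                        insertFirst i v ≡ insertFirst j w → i ≡ j × v ≡ w
insertFirst-injective {i = i} eq with ∷-injective eq
... | refl , eq′ = refl , map-injective (Fin.punchIn-injective i _ _) eq′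

permutations : ∀ n → List (Word n)
permutations zero    = [ [] ]
permutations (suc n) = cartesianProductWith insertFirst (allFin (suc n)) (permutations n)

length-permutations : ∀ n → length (permutations n) ≡ n !
length-permutations zero    = refl
length-permutations (suc n) = trans
  (length-cartesianProductWith insertFirst (allFin (suc n)) (permutations n))
  (cong₂ ℕ._*_ (length-tabulate {n = suc n} (λ i → i)) (length-permutations n))

-- Distinctness lets the permutations inside a word be counted by its subsequences, through
-- `unique-⊆⇒length≤`.
permutations-unique : ∀ n → Unique (permutations n)
permutations-unique zero    = [] ∷ []
permutations-unique (suc n) = Unique.cartesianProductWith⁺ insertFirst insertFirst-injective
  (Unique.allFin⁺ (suc n)) (permutations-unique n)

insertFirst-isPermutation : ∀ {n} (i : Fin (suc n)) {w : Word n} →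
                            IsPermutation w → IsPermutation (insertFirst i w)
insertFirst-isPermutation i {w} perm = record
  { atMostOnce  = All.map⁺ (All.tabulate (λ {j} _ eq → Fin.punchInᵢ≢i i j (sym eq)))
                ∷ Unique.map⁺ (Fin.punchIn-injective i _ _) atMostOnce
  ; atLeastOnce = mem
  }
  where
  open IsPermutation perm
  mem : ∀ j → j ∈ insertFirst i w
  mem j with i Fin.≟ j
  ... | yes refl = here refl
  ... | no i≢j   = there (subst (_∈ map (punchIn i) w) (Fin.punchIn-punchOut i≢j)
                     (∈-map⁺ (punchIn i) (atLeastOnce (punchOut i≢j))))

∈-permutations⁻ : ∀ n {w} → w ∈ permutations n → IsPermutation w × length w ≡ n
∈-permutations⁻ zero    (here refl) = record { atMostOnce = [] ; atLeastOnce = λ () } , refl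
∈-permutations⁻ (suc n) w∈
  with i , v , _ , v∈ , refl ← ∈-cartesianProductWith⁻ insertFirst (allFin (suc n)) (permutations n) w∈
  with perm , len ← ∈-permutations⁻ n v∈
  = insertFirst-isPermutation i perm , cong suc (trans (length-map (punchIn i) v) len)

wordsUpTo : ℕ → List A → List (List A)
wordsUpTo zero    as = [ [] ]
wordsUpTo (suc l) as = [] ∷ cartesianProductWith _∷_ as (wordsUpTo l as)

-- The empty word added at each stage is absorbed by one further copy of the power for `l`, hence
-- the base `suc (length as)`.
length-wordsUpTo : ∀ l (as : List A) → length (wordsUpTo l as) ℕ.≤ suc (length as) ^ l
length-wordsUpTo zero    as = ℕ.≤-refl
length-wordsUpTo (suc l) as = begin
  suc (length (cartesianProductWith _∷_ as (wordsUpTo l as)))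
    ≡⟨ cong suc (length-cartesianProductWith _∷_ as (wordsUpTo l as)) ⟩
  suc (length as ℕ.* length (wordsUpTo l as))
    ≤⟨ ℕ.+-mono-≤ (ℕ.m^n>0 (suc (length as)) l) (ℕ.*-monoʳ-≤ (length as) (length-wordsUpTo l as)) ⟩
  suc (length as) ^ suc l ∎
  where open ℕ.≤-Reasoning

∈-wordsUpTo⁺ : ∀ {l} {as w : List A} → length w ℕ.≤ l → All (_∈ as) w → w ∈ wordsUpTo l as
∈-wordsUpTo⁺ {l = zero}  {w = []} _ _ = here refl
∈-wordsUpTo⁺ {l = suc l} {w = []} _ _ = here refl
∈-wordsUpTo⁺ {l = suc l} (s≤s w≤l) (x∈as ∷ w⊆as) =
  there (∈-cartesianProductWith⁺ _∷_ x∈as (∈-wordsUpTo⁺ w≤l w⊆as))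

∈-wordsUpTo⁻ : ∀ l (as : List A) {w} → w ∈ wordsUpTo l as → length w ℕ.≤ l
∈-wordsUpTo⁻ zero    as (here refl) = z≤n
∈-wordsUpTo⁻ (suc l) as (here refl) = z≤n
∈-wordsUpTo⁻ (suc l) as (there w∈)
  with _ , _ , _ , v∈ , refl ← ∈-cartesianProductWith⁻ _∷_ as (wordsUpTo l as) w∈
  = s≤s (∈-wordsUpTo⁻ l as v∈)

_⊆?_ : ∀ {n} → B.Decidable (_⊆_ {A = Fin n})
_⊆?_ = DecSublist._⊆?_ Fin._≟_

-- Short words and the forcing family.

short⇒rare : ∀ n {w : Word n} → length w ℕ.* 32 ℕ.≤ n ^ 2 →
             Rare _⊆?_ (permutations n) (2 ^ n) w
short⇒rare n {w} short = begin
  length (filter (_⊆? w) (permutations n)) ℕ.* 2 ^ n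
    ≤⟨ ℕ.*-monoˡ-≤ (2 ^ n) (unique-⊆⇒length≤ (Unique.filter⁺ (_⊆? w) (permutations-unique n)) embed) ⟩
  length (subsequences n w) ℕ.* 2 ^ n
    ≤⟨ length-subsequences*2^n≤n! n w short ⟩
  n !
    ≡⟨ length-permutations n ⟨
  length (permutations n) ∎
  where
  open ℕ.≤-Reasoning
  embed : ∀ {s} → s ∈ filter (_⊆? w) (permutations n) → s ∈ subsequences n w
  embed {s} s∈ with s∈perms , s⊆w ← ∈-filter⁻ (_⊆? w) {xs = permutations n} s∈ =
    subst (λ k → s ∈ subsequences k w) (proj₂ (∈-permutations⁻ n s∈perms)) (∈-subsequences s⊆w)

n<2^n : ∀ n → n ℕ.< 2 ^ n
n<2^n zero    = s≤s z≤n
n<2^n (suc n) = ℕ.+-mono-≤ (ℕ.m^n>0 2 n) (ℕ.≤-trans (n<2^n n) (ℕ.m≤m+n (2 ^ n) 0))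

module _ (n L : ℕ) .{{_ : NonZero n}} (short : L ℕ.* 32 ℕ.≤ n ^ 2) where

  private
    few-words : length (wordsUpTo L (allFin n)) ℕ.< (2 ^ n) ^ suc L
    few-words = begin-strict
      length (wordsUpTo L (allFin n))  ≤⟨ length-wordsUpTo L (allFin n) ⟩
      suc (length (allFin n)) ^ L      ≡⟨ cong (λ k → suc k ^ L) (length-tabulate {n = n} (λ i → i)) ⟩
      suc n ^ L                        ≤⟨ ℕ.^-monoˡ-≤ L (n<2^n n) ⟩
      -- Since `n` is nonzero, `2 ^ n` exceeds 1, so one further factor makes the inequality strict.
      -- This is why `suc L` permutations are chosen.
      (2 ^ n) ^ L                      <⟨ ℕ.^-monoʳ-< (2 ^ n) (ℕ.≤-trans (s≤s (ℕ.>-nonZero⁻¹ n)) (n<2^n n)) (ℕ.n<1+n L) ⟩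
      (2 ^ n) ^ suc L                  ∎
      where open ℕ.≤-Reasoning

    all-rare : All (Rare _⊆?_ (permutations n) (2 ^ n)) (wordsUpTo L (allFin n))
    all-rare = All.tabulate λ w∈ → short⇒rare n
      (ℕ.≤-trans (ℕ.*-monoˡ-≤ 32 (∈-wordsUpTo⁻ L (allFin n) w∈)) short)

    permutations-nonempty : 1 ℕ.≤ length (permutations n)
    permutations-nonempty = subst (1 ℕ.≤_) (sym (length-permutations n)) (ℕ.1≤n! n)

  -- The greedy choice is run against every word of length at most `L`. None of them survives, so a
  -- word containing the whole family must be longer.
  ∃-forcing-family : Σ[ S ∈ List (Word n) ]
    Unique S × All IsPermutation S × length S ℕ.≤ suc L ×
    (∀ (w : Word n) → All (_⊆ w) S → L ℕ.< length w)
  ∃-forcing-family =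
    let S , len , S⊆perms , avoid = ∃-avoiding-family _⊆?_ (permutations n) (2 ^ n)
          permutations-nonempty (suc L) all-rare few-words
    -- The greedy choices can repeat, for instance once no words are left; removing repetitions
    -- yields a genuine set and imposes the same containments.
    in deduplicate _≟ʷ_ S
     , DecUnique.deduplicate-! _≟ʷ_ S
     , All.deduplicate⁺ _≟ʷ_ (All.map (λ s∈ → proj₁ (∈-permutations⁻ n s∈)) S⊆perms)
     , ℕ.≤-trans (length-deduplicate _≟ʷ_ S) (ℕ.≤-reflexive len)
     , λ w S⊆w → ℕ.≰⇒> λ w≤L → avoid
         (∈-wordsUpTo⁺ {l = L} {as = allFin n} w≤L (All.tabulate λ {i} _ → ∈-allFin i))
         (All.tabulate λ {s} s∈S → All.lookup S⊆w (∈-deduplicate⁺ _≟ʷ_ {xs = S} {z = s} s∈S))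
    where
    _≟ʷ_ : B.DecidableEquality (Word n)
    _≟ʷ_ = ≡-dec Fin._≟_

-- Rounding, binary length and its growth.

floor/32 : ∀ m → 1 ℕ.≤ m → ∃[ q ] (q ℕ.* 32 ℕ.≤ m × q ℕ.< m × m ℕ.≤ suc q ℕ.* 32)
floor/32 m 1≤m = m ℕ./ 32 , m/n*n≤m m 32 , m/n<m m 32 {{ℕ.>-nonZero 1≤m}} (s≤s (s≤s z≤n))
               , subst (ℕ._≤ suc (m ℕ./ 32) ℕ.* 32) (sym (m≡m%n+[m/n]*n m 32))
                   (ℕ.+-monoˡ-≤ (m ℕ./ 32 ℕ.* 32) (ℕ.<⇒≤ (m%n<n m 32)))

-- The exponent is the binary length of `n`, taken as 0 for 0.
dyadic-bracket : ∀ n → ∃[ k ] (n ℕ.< 2 ^ k × 2 ^ k ℕ.≤ suc (2 ℕ.* n))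
dyadic-bracket zero = 0 , s≤s z≤n , s≤s z≤n
dyadic-bracket (suc n) with dyadic-bracket n
... | k , n<2^k , 2^k≤ with suc n ℕ.<? 2 ^ k
...   | yes 1+n<2^k = k , 1+n<2^k , ℕ.≤-trans 2^k≤ (s≤s (ℕ.*-monoʳ-≤ 2 (ℕ.n≤1+n n)))
-- Here `suc n` equals `2 ^ k`, so one more binary digit is needed.
...   | no  1+n≮2^k with eq ← ℕ.≤-antisym n<2^k (ℕ.≮⇒≥ 1+n≮2^k) =
  suc k
  , subst (λ t → suc n ℕ.< 2 ℕ.* t) eq (ℕ.m<m+n (suc n) (s≤s z≤n))
  , subst (λ t → 2 ℕ.* t ℕ.≤ suc (2 ℕ.* suc n)) eq (ℕ.n≤1+n _)

bits : ℕ → ℕ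
bits n = proj₁ (dyadic-bracket n)

-- The lower-order terms make the bound on `k * k` inductive: the left-hand side at `suc k` falls
-- short of twice the one at `k` by exactly `k * k`.
k²+2k+3≤4*2^k : ∀ k → k ℕ.* k ℕ.+ 2 ℕ.* k ℕ.+ 3 ℕ.≤ 4 ℕ.* 2 ^ k
k²+2k+3≤4*2^k zero    = s≤s (s≤s (s≤s z≤n))
k²+2k+3≤4*2^k (suc k) = begin
  suc k ℕ.* suc k ℕ.+ 2 ℕ.* suc k ℕ.+ 3                          ≤⟨ ℕ.m≤m+n _ (k ℕ.* k) ⟩
  suc k ℕ.* suc k ℕ.+ 2 ℕ.* suc k ℕ.+ 3 ℕ.+ k ℕ.* k              ≡⟨ expand k ⟩
  2 ℕ.* (k ℕ.* k ℕ.+ 2 ℕ.* k ℕ.+ 3)                              ≤⟨ ℕ.*-monoʳ-≤ 2 (k²+2k+3≤4*2^k k) ⟩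
  2 ℕ.* (4 ℕ.* 2 ^ k)                                            ≡⟨ x∙yz≈y∙xz ℕ.*-commutativeSemigroup 2 4 (2 ^ k) ⟩
  4 ℕ.* 2 ^ suc k                                                ∎
  where
  open ℕ.≤-Reasoning
  expand : ∀ k → suc k ℕ.* suc k ℕ.+ 2 ℕ.* suc k ℕ.+ 3 ℕ.+ k ℕ.* k ≡ 2 ℕ.* (k ℕ.* k ℕ.+ 2 ℕ.* k ℕ.+ 3)
  expand = solve-∀

-- A logarithm of at most square-root order already gives sublinearity. The constant is 4 · 3, since
-- `2 ^ bits n` is at most `suc (2 * n)` and so, for positive `n`, at most `3 * n`.
bits²≤12n : ∀ n .{{_ : NonZero n}} → bits n ℕ.* bits n ℕ.≤ 12 ℕ.* n
bits²≤12n n = begin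
  k ℕ.* k                       ≤⟨ ℕ.≤-trans (ℕ.m≤m+n _ (2 ℕ.* k)) (ℕ.m≤m+n _ 3) ⟩
  k ℕ.* k ℕ.+ 2 ℕ.* k ℕ.+ 3     ≤⟨ k²+2k+3≤4*2^k k ⟩
  4 ℕ.* 2 ^ k                   ≤⟨ ℕ.*-monoʳ-≤ 4 (proj₂ (proj₂ (dyadic-bracket n))) ⟩
  4 ℕ.* suc (2 ℕ.* n)           ≤⟨ ℕ.*-monoʳ-≤ 4 (ℕ.+-monoˡ-≤ (2 ℕ.* n) (ℕ.>-nonZero⁻¹ n)) ⟩
  4 ℕ.* (n ℕ.+ 2 ℕ.* n)         ≡⟨ collect n ⟩
  12 ℕ.* n                      ∎
  where
  open ℕ.≤-Reasoning
  k : ℕ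
  k = bits n
  collect : ∀ n → 4 ℕ.* (n ℕ.+ 2 ℕ.* n) ≡ 12 ℕ.* n
  collect = solve-∀

-- This is where the exponent `2 * bits n` of the theorem comes from: its families have at most
-- `n ^ 2` members.
n²≤2^[2*bits] : ∀ n → n ^ 2 ℕ.≤ 2 ^ (2 ℕ.* bits n)
n²≤2^[2*bits] n = begin
  n ^ 2               ≤⟨ ℕ.^-monoˡ-≤ 2 (ℕ.<⇒≤ (proj₁ (proj₂ (dyadic-bracket n)))) ⟩
  (2 ^ bits n) ^ 2    ≡⟨ ℕ.^-*-assoc 2 (bits n) 2 ⟩
  2 ^ (bits n ℕ.* 2)  ≡⟨ cong (2 ^_) (ℕ.*-comm (bits n) 2) ⟩
  2 ^ (2 ℕ.* bits n)  ∎
  where open ℕ.≤-Reasoning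

-- If n ≤ 2q·bits n, squaring gives n² ≤ 4q²·12n, hence n ≤ 48q².
2*bits*q<n : ∀ q n .{{_ : NonZero n}} → suc (48 ℕ.* (q ℕ.* q)) ℕ.≤ n → 2 ℕ.* bits n ℕ.* q ℕ.< n
2*bits*q<n q n large = ℕ.≰⇒> λ n≤ → ℕ.<⇒≱ large (ℕ.*-cancelʳ-≤ n (48 ℕ.* (q ℕ.* q)) n (begin
  n ℕ.* n                                            ≤⟨ ℕ.*-mono-≤ n≤ n≤ ⟩
  2 ℕ.* bits n ℕ.* q ℕ.* (2 ℕ.* bits n ℕ.* q)        ≡⟨ regroup (bits n) q ⟩
  4 ℕ.* (q ℕ.* q) ℕ.* (bits n ℕ.* bits n)            ≤⟨ ℕ.*-monoʳ-≤ (4 ℕ.* (q ℕ.* q)) (bits²≤12n n) ⟩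
  4 ℕ.* (q ℕ.* q) ℕ.* (12 ℕ.* n)                     ≡⟨ regroup′ (q ℕ.* q) n ⟩
  48 ℕ.* (q ℕ.* q) ℕ.* n                             ∎))
  where
  open ℕ.≤-Reasoning
  regroup : ∀ b q → 2 ℕ.* b ℕ.* q ℕ.* (2 ℕ.* b ℕ.* q) ≡ 4 ℕ.* (q ℕ.* q) ℕ.* (b ℕ.* b)
  regroup = solve-∀
  regroup′ : ∀ s n → 4 ℕ.* s ℕ.* (12 ℕ.* n) ≡ 48 ℕ.* s ℕ.* n
  regroup′ = solve-∀

-- Rational inequalities and the conclusion.

-- The constructor form lets _≤2^_ reduce, which fromℕ m does not for a variable m.
integral : ℕ → ℚ
integral m = mkℚ (+ m) 0 (coprime-sym (1-coprimeTo m))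

fromℕ≡integral : ∀ m → fromℕ m ≡ integral m
fromℕ≡integral m = ℚ.normalize-coprime (coprime-sym (1-coprimeTo m))

0≤integral : ∀ m → 0ℚ ≤ integral m
0≤integral m = *≤* (subst (+ 0 ℤ.≤_) (sym (ℤ.*-identityʳ (+ m))) (ℤ.+≤+ z≤n))

1/32ℚ : ℚ
1/32ℚ = + 1 / 32

-- Unnormalised fractions are compared by cross-multiplication, which reduces the claim to its
-- hypothesis over the integers.
1/32*-≤ : ∀ m k → m ℕ.≤ k ℕ.* 32 → 1/32ℚ * fromℕ m ≤ fromℕ k
1/32*-≤ m k m≤ rewrite fromℕ≡integral m | fromℕ≡integral k =
  ℚ.toℚᵘ-cancel-≤ (ℚᵘ.≤-respˡ-≃ (ℚᵘ.≃-sym (ℚ.toℚᵘ-homo-* 1/32ℚ (integral m)))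
    (ℚᵘ.*≤* (begin
      + 1 ℤ.* + m ℤ.* + 1   ≡⟨ trans (ℤ.*-identityʳ _) (ℤ.*-identityˡ (+ m)) ⟩
      + m                   ≤⟨ ℤ.+≤+ m≤ ⟩
      + (k ℕ.* 32)          ≡⟨ ℤ.pos-* k 32 ⟩
      + k ℤ.* + 32          ∎)))
  where open ℤ.≤-Reasoning

-- A positive rational is at least the reciprocal of its denominator, so `m / n` only has to stay
-- below that reciprocal.
integral*1/n<ε : ∀ m n .{{_ : NonZero n}} ε → 0ℚ < ε → m ℕ.* ↧ₙ ε ℕ.< n →
                 ∣ integral m * (+ 1 / n) ∣ < ε
integral*1/n<ε m n       (mkℚ (+ zero) d _) (*<* (ℤ.+<+ ()))
integral*1/n<ε m n       (mkℚ -[1+ p ] d _) (*<* ())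
integral*1/n<ε m (suc n) (mkℚ (+ suc p) d _) _ m<
  rewrite ℚ.normalize-coprime {1} {n} (1-coprimeTo (suc n)) =
  ℚ.toℚᵘ-cancel-< (ℚᵘ.<-respˡ-≃ (ℚᵘ.≃-sym abs≃) (ℚᵘ.*<* (begin-strict
    + ℤ.∣ + m ℤ.* + 1 ∣ ℤ.* + suc d   ≡⟨ cong (λ z → + ℤ.∣ z ∣ ℤ.* + suc d) (ℤ.*-identityʳ (+ m)) ⟩
    + m ℤ.* + suc d                   ≡⟨ ℤ.pos-* m (suc d) ⟨
    + (m ℕ.* suc d)                   <⟨ ℤ.+<+ m< ⟩
    + suc n                           ≤⟨ ℤ.+≤+ (ℕ.≤-trans (ℕ.m≤n*m (suc n) (suc p)) (ℕ.*-monoʳ-≤ (suc p) (ℕ.m≤n*m (suc n) 1))) ⟩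
    + (suc p ℕ.* (1 ℕ.* suc n))       ≡⟨ ℤ.pos-* (suc p) (1 ℕ.* suc n) ⟩
    + suc p ℤ.* + (1 ℕ.* suc n)       ∎)))
  where
  open ℤ.≤-Reasoning
  1/n : ℚ
  1/n = mkℚ (+ 1) n (1-coprimeTo (suc n))
  abs≃ : toℚᵘ ∣ integral m * 1/n ∣ ℚᵘ.≃ ℚᵘ.∣ toℚᵘ (integral m) ℚᵘ.* toℚᵘ 1/n ∣
  abs≃ = ℚᵘ.≃-trans (ℚ.toℚᵘ-homo-∣-∣ (integral m * 1/n)) (ℚᵘ.∣-∣-cong (ℚ.toℚᵘ-homo-* (integral m) 1/n))

sublinear-2*bits : Sublinear (λ n → integral (2 ℕ.* bits n))
sublinear-2*bits ε 0<ε = suc (48 ℕ.* (↧ₙ ε ℕ.* ↧ₙ ε)) ,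
  λ n large → integral*1/n<ε (2 ℕ.* bits n) n ε 0<ε (2*bits*q<n (↧ₙ ε) n large)

theorem3 : Σ[ c ∈ ℚ ] Σ[ g ∈ (ℕ → ℚ) ]
    0ℚ < c
    × (∀ (n : ℕ) → 0ℚ ≤ g n)
    × Sublinear g
    × (∀ (n : ℕ) → 1 ℕ.≤ n →
    Σ[ S ∈ List (Word n) ]
    Unique S
    × All IsPermutation S
    × length S ≤2^ g n
    × (∀ (w : Word n) → All (λ s → s ⊆ w) S →
    c * fromℕ (n ℕ.^ 2) ≤ fromℕ (length w)))
theorem3 = 1/32ℚ , (λ n → integral (2 ℕ.* bits n)) , *<* (ℤ.+<+ (s≤s z≤n)) , (λ n → 0≤integral _) , sublinear-2*bits
  , λ n 1≤n →
      let
        -- Rounding down makes words of length `L` short and keeps `suc L` at most `n ^ 2`, while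
        -- `n ^ 2` is still at most 32 times `suc L`.
        L , short , L<n² , n²≤ = floor/32 (n ^ 2) (ℕ.^-monoˡ-≤ 2 1≤n)
        S , S! , perms , small , forced = ∃-forcing-family n L {{ℕ.>-nonZero 1≤n}} short
      in S , S! , perms
       -- The exponent has denominator 1, so `_≤2^_` asks for a bound on `length S ^ 1`.
       , ℕ.≤-trans (ℕ.≤-reflexive (ℕ.*-identityʳ _)) (ℕ.≤-trans small (ℕ.≤-trans L<n² (n²≤2^[2*bits] n)))
       , λ w S⊆w → 1/32*-≤ (n ^ 2) (length w) (ℕ.≤-trans n²≤ (ℕ.*-monoˡ-≤ 32 (forced w S⊆w)))
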